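{- For all positive integers $n,m$ with $n-1\le m\le \binom n2$, $$\tilde{r}(\mathcal{C}_{\mathrm{odd}},\mathcal{C}on_{n,m})\ \ge\ \varphi n + m-2\varphi+1,$$ where $\varphi=(1+\sqrt5)/2$ is the golden ratio.
   Context: For nonempty families $\mathcal H_1,\mathcal H_2$ of finite graphs, the online size Ramsey game $\tilde R(\mathcal H_1,\mathcal H_2)$ is played on the edge set of the complete graph $K_{\mathbb N}$ on vertex set $\mathbb N$: in each round Builder selects a previously unselected edge and Painter colours it red or blue. The game ends as soon as, after Painter's move, there is a red copy of some graph from $\mathcal H_1$ or a blue copy of some graph from $\mathcal H_2$. Builder aims to end the game as quickly as possible, Painter to delay it. The online size Ramsey number $\tilde{r}(\mathcal H_1,\mathcal H_2)$ is the number of rounds the game lasts when both players play optimally. (For single graphs $H_i$ one writes $\tilde r(H_1,H_2)$.) $\mathcal{C}_{\mathrm{odd}}$ denotes the family of all odd cycles, and $\mathcal{C}on_{n,m}$ denotes the family of all connected graphs with exactly $n$ vertices and at least $m$ edges. -}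

module Defs where

open import Data.Nat as ℕ using (ℕ; zero; suc; _+_; _*_; _<_; _≤_)
open import Data.Integer as ℤ using (ℤ; +_)
open import Data.Fin as Fin using (Fin)
open import Data.Product using (_×_; _,_; Σ; ∃; ∃-syntax; proj₁; proj₂)
open import Data.Sum using (_⊎_)
open import Data.List using (List; []; _∷_; length)
open import Data.List.Membership.Propositional using (_∈_)
open import Data.List.Relation.Unary.All using (All)
open import Data.List.Relation.Unary.Unique.Propositional using (Unique)
open import Relation.Binary.Construct.Closure.ReflexiveTransitive using (Star)
open import Relation.Binary.PropositionalEquality using (_≡_)
open import Relation.Nullary using (¬_)
open import Function.Definitions using (Injective)

-- The board: K_ℕ.  An edge {i,j} (i < j) is recorded as the pair (i , j).

data Colour : Set where
  red blue : Colour

History : Set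
History = List (Colour × ℕ × ℕ)

Adj : Colour → History → ℕ → ℕ → Set
Adj c h u v = ((c , u , v) ∈ h) ⊎ ((c , v , u) ∈ h)

Selected : History → ℕ → ℕ → Set
Selected h u v = Adj red h u v ⊎ Adj blue h u v

RedOddCycle : History → Set
RedOddCycle h =
  Σ ℕ λ k → Σ (ℕ → ℕ) λ v →
    let L = 3 + 2 * k in
    (∀ i j → i < L → j < L → v i ≡ v j → i ≡ j)
    × (∀ i → suc i < L → Adj red h (v i) (v (suc i)))
    × Adj red h (v (ℕ.pred L)) (v 0)

record ConGraph (n m : ℕ) : Set where
  field
    edges     : List (Fin n × Fin n)
    ordered   : All (λ e → Fin._<_ (proj₁ e) (proj₂ e)) edges
    distinct  : Unique edges
    manyEdges : m ≤ length edges

  GAdj : Fin n → Fin n → Set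
  GAdj a b = ((a , b) ∈ edges) ⊎ ((b , a) ∈ edges)

  field
    connected : ∀ a b → Star GAdj a b

open ConGraph public

BlueCon : ℕ → ℕ → History → Set
BlueCon n m h =
  Σ (ConGraph n m) λ G → Σ (Fin n → ℕ) λ f →
    Injective _≡_ _≡_ f × (∀ a b → GAdj G a b → Adj blue h (f a) (f b))

GameOver : ℕ → ℕ → History → Set
GameOver n m h = RedOddCycle h ⊎ BlueCon n m h

-- Online game: BuilderWins End t h  means that from position h Builder
-- has a strategy guaranteeing that the game ends within t further rounds
-- whatever Painter does.  Ending is only checked after Painter's move.

data BuilderWins (End : History → Set) : ℕ → History → Set where
  move : ∀ {t h} (i j : ℕ) → i < j → ¬ Selected h i j →
         (∀ c → End ((c , i , j) ∷ h) ⊎ BuilderWins End t ((c , i , j) ∷ h)) →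
         BuilderWins End (suc t) h

-- "r̃(C_odd, Con_{n,m}) ≥ x" for a real x: Builder cannot force the end
-- within t rounds unless x ≤ t.  (If Builder cannot force the end at all,
-- r̃ = ∞ and this holds.)
OnlineRamseyAtLeast : ℕ → ℕ → (ℕ → Set) → Set
OnlineRamseyAtLeast n m LowerLe = ∀ t → BuilderWins (GameOver n m) t [] → LowerLe t

Sqrt5MulLe : ℤ → ℤ → Set
Sqrt5MulLe a b =
  (ℤ._≤_ (+ 0) a → ℤ._≤_ (+ 0) b × ℤ._≤_ (+ 5 ℤ.* (a ℤ.* a)) (b ℤ.* b))
  × (ℤ._<_ a (+ 0) → ℤ._≤_ (+ 0) b ⊎ ℤ._≤_ (b ℤ.* b) (+ 5 ℤ.* (a ℤ.* a)))

-- φ n + m − 2φ + 1 ≤ t, with φ = (1+√5)/2, i.e.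
-- √5 (n−2) ≤ 2 (t − m − 1) − (n − 2).
GoldenBoundLe : ℕ → ℕ → ℕ → Set
GoldenBoundLe n m t =
  let a = + n ℤ.- + 2 in
  Sqrt5MulLe a ((+ 2) ℤ.* (+ t ℤ.- + m ℤ.- + 1) ℤ.- a)

{-# OPTIONS --safe #-}

-- Painter keeps every component of the coloured graph balanced: its vertices split into two
-- sides, red edges run between the sides and blue edges inside a side.  So red is bipartite, an
-- edge within a component has a forced colour, and Painter only chooses when two components merge.
-- For a component whose sides A, B have a, b vertices, let x (y) be the number of its edges not
-- inside A (B), and put S = x − φ a, T = y − φ b.  Painter maintains, for every component with
-- at least two vertices, S, T ≥ −√5, S + φ T ≥ −φ and T + φ S ≥ −φ.  An edge between sides A₁ and
-- A₂ merges to (S₁ + T₂ + 1, T₁ + S₂ + 1) when red and to (S₁ + S₂, T₁ + T₂ + 1) when blue, and if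
-- red violates the invariant then blue preserves it.  A blue connected graph with n vertices and
-- m edges lies in one side A, so the game lasts at least m + x ≥ m + φ a − √5 ≥ m + φ n − 2φ + 1
-- rounds.
module Submission where

open import Defs
open import Algebra.Bundles using (CommutativeRing)
open import Algebra.Solver.Ring.AlmostCommutativeRing using (fromCommutativeRing)
open import Data.Bool using (Bool; true; false; not; _xor_; if_then_else_)
open import Data.Bool.Properties using (not-involutive; not-¬; not-distribˡ-xor)
open import Data.Fin as Fin using (Fin)
import Data.Fin.Properties as Fin
open import Data.Integer as ℤ using (ℤ; +_; -[1+_]; 0ℤ; 1ℤ; +≤+)
import Data.Integer.Properties as ℤ
open import Data.Integer.Tactic.RingSolver using (solve-∀)
open import Data.List using (List; []; _∷_; _++_; map; length; filter; lookup)
open import Data.List.Membership.Propositional using (_∈_)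
open import Data.List.Membership.Propositional.Properties using (∈-++⁺ˡ; ∈-++⁺ʳ; ∈-filter⁺; ∈-lookup)
open import Data.List.Membership.Setoid.Properties using (index-injective)
open import Data.List.Properties using (length-++)
import Data.List.Relation.Unary.All as All
open import Data.List.Relation.Unary.AllPairs using (_∷_)
open import Data.List.Relation.Unary.Any using (here; there; index)
open import Data.List.Relation.Unary.Unique.Propositional using (Unique)
open import Data.Nat using (ℕ; zero; suc; _+_; _*_; _∸_; _≤_; _<_; z≤n; s≤s; _≟_)
open import Data.Nat.Combinatorics using (_C_)
open import Data.Nat.ListAction using (sum)
import Data.Nat.Properties as ℕ
open import Algebra.Properties.CommutativeSemigroup ℕ.+-commutativeSemigroup using () renaming (interchange to +-interchange)
open import Data.Product using (_×_; _,_; proj₁; proj₂; ∃-syntax)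
open import Data.Sum as Sum using (_⊎_; inj₁; inj₂)
open import Function using (_∘_)
open import Function.Definitions using (Injective)
open import Level using (0ℓ)
open import Relation.Binary.Construct.Closure.ReflexiveTransitive using (Star; ε; _◅_)
open import Relation.Binary.PropositionalEquality
open import Relation.Nullary using (Dec; yes; no; ¬_; contradiction)

-- The ring ℤ[φ].

infix 5 _+φ_

-- p +φ q stands for p + q φ.
record ℤ[φ] : Set where
  constructor _+φ_
  field
    re im : ℤ

infixl 6 _⊕_
infixl 7 _⊗_
infix  8 ⊝_

_⊕_ _⊗_ : ℤ[φ] → ℤ[φ] → ℤ[φ]
(p +φ q) ⊕ (r +φ s) = (p ℤ.+ r) +φ (q ℤ.+ s)
(p +φ q) ⊗ (r +φ s) = (p ℤ.* r ℤ.+ q ℤ.* s) +φ (p ℤ.* s ℤ.+ q ℤ.* r ℤ.+ q ℤ.* s)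

⊝_ : ℤ[φ] → ℤ[φ]
⊝ (p +φ q) = ℤ.- p +φ ℤ.- q

𝟘 𝟙 φ : ℤ[φ]
𝟘 = 0ℤ +φ 0ℤ
𝟙 = 1ℤ +φ 0ℤ
φ = 0ℤ +φ 1ℤ

⊕-comm : ∀ x y → x ⊕ y ≡ y ⊕ x
⊕-comm (p +φ q) (r +φ s) = cong₂ _+φ_ (ℤ.+-comm p r) (ℤ.+-comm q s)

⊕-assoc : ∀ x y z → (x ⊕ y) ⊕ z ≡ x ⊕ (y ⊕ z)
⊕-assoc (p +φ q) (r +φ s) (t +φ u) = cong₂ _+φ_ (ℤ.+-assoc p r t) (ℤ.+-assoc q s u)

⊕-identityˡ : ∀ x → 𝟘 ⊕ x ≡ x
⊕-identityˡ (p +φ q) = cong₂ _+φ_ (ℤ.+-identityˡ p) (ℤ.+-identityˡ q)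

⊕-identityʳ : ∀ x → x ⊕ 𝟘 ≡ x
⊕-identityʳ x = trans (⊕-comm x 𝟘) (⊕-identityˡ x)

⊕-inverseˡ : ∀ x → ⊝ x ⊕ x ≡ 𝟘
⊕-inverseˡ (p +φ q) = cong₂ _+φ_ (ℤ.+-inverseˡ p) (ℤ.+-inverseˡ q)

⊗-comm : ∀ x y → x ⊗ y ≡ y ⊗ x
⊗-comm (p +φ q) (r +φ s) = cong₂ _+φ_ (re-comm p q r s) (im-comm p q r s)
  where
  re-comm : ∀ p q r s → p ℤ.* r ℤ.+ q ℤ.* s ≡ r ℤ.* p ℤ.+ s ℤ.* q
  re-comm = solve-∀
  im-comm : ∀ p q r s → p ℤ.* s ℤ.+ q ℤ.* r ℤ.+ q ℤ.* s ≡ r ℤ.* q ℤ.+ s ℤ.* p ℤ.+ s ℤ.* q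
  im-comm = solve-∀

⊗-assoc : ∀ x y z → (x ⊗ y) ⊗ z ≡ x ⊗ (y ⊗ z)
⊗-assoc (p +φ q) (r +φ s) (t +φ u) = cong₂ _+φ_ (re-assoc p q r s t u) (im-assoc p q r s t u)
  where
  re-assoc : ∀ p q r s t u →
    (p ℤ.* r ℤ.+ q ℤ.* s) ℤ.* t ℤ.+ (p ℤ.* s ℤ.+ q ℤ.* r ℤ.+ q ℤ.* s) ℤ.* u
    ≡ p ℤ.* (r ℤ.* t ℤ.+ s ℤ.* u) ℤ.+ q ℤ.* (r ℤ.* u ℤ.+ s ℤ.* t ℤ.+ s ℤ.* u)
  re-assoc = solve-∀
  im-assoc : ∀ p q r s t u →
    (p ℤ.* r ℤ.+ q ℤ.* s) ℤ.* u ℤ.+ (p ℤ.* s ℤ.+ q ℤ.* r ℤ.+ q ℤ.* s) ℤ.* t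
      ℤ.+ (p ℤ.* s ℤ.+ q ℤ.* r ℤ.+ q ℤ.* s) ℤ.* u
    ≡ p ℤ.* (r ℤ.* u ℤ.+ s ℤ.* t ℤ.+ s ℤ.* u) ℤ.+ q ℤ.* (r ℤ.* t ℤ.+ s ℤ.* u)
      ℤ.+ q ℤ.* (r ℤ.* u ℤ.+ s ℤ.* t ℤ.+ s ℤ.* u)
  im-assoc = solve-∀

⊗-identityˡ : ∀ x → 𝟙 ⊗ x ≡ x
⊗-identityˡ (p +φ q) = cong₂ _+φ_ (re-id p q) (im-id p q)
  where
  re-id : ∀ p q → 1ℤ ℤ.* p ℤ.+ 0ℤ ℤ.* q ≡ p
  re-id = solve-∀
  im-id : ∀ p q → 1ℤ ℤ.* q ℤ.+ 0ℤ ℤ.* p ℤ.+ 0ℤ ℤ.* q ≡ q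
  im-id = solve-∀

⊗-distribʳ-⊕ : ∀ x y z → (y ⊕ z) ⊗ x ≡ (y ⊗ x) ⊕ (z ⊗ x)
⊗-distribʳ-⊕ (p +φ q) (r +φ s) (t +φ u) = cong₂ _+φ_ (re-distrib p q r s t u) (im-distrib p q r s t u)
  where
  re-distrib : ∀ p q r s t u → (r ℤ.+ t) ℤ.* p ℤ.+ (s ℤ.+ u) ℤ.* q
    ≡ (r ℤ.* p ℤ.+ s ℤ.* q) ℤ.+ (t ℤ.* p ℤ.+ u ℤ.* q)
  re-distrib = solve-∀
  im-distrib : ∀ p q r s t u → (r ℤ.+ t) ℤ.* q ℤ.+ (s ℤ.+ u) ℤ.* p ℤ.+ (s ℤ.+ u) ℤ.* q
    ≡ (r ℤ.* q ℤ.+ s ℤ.* p ℤ.+ s ℤ.* q) ℤ.+ (t ℤ.* q ℤ.+ u ℤ.* p ℤ.+ u ℤ.* q)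
  im-distrib = solve-∀

ℤ[φ]-commutativeRing : CommutativeRing 0ℓ 0ℓ
ℤ[φ]-commutativeRing = record
  { Carrier = ℤ[φ]
  ; _≈_ = _≡_
  ; _+_ = _⊕_
  ; _*_ = _⊗_
  ; -_ = ⊝_
  ; 0# = 𝟘
  ; 1# = 𝟙
  ; isCommutativeRing = record
    { isRing = record
      { +-isAbelianGroup = record
        { isGroup = record
          { isMonoid = record
            { isSemigroup = record
              { isMagma = record { isEquivalence = isEquivalence ; ∙-cong = cong₂ _⊕_ }
              ; assoc = ⊕-assoc
              }
            ; identity = ⊕-identityˡ , ⊕-identityʳ
            }
          ; inverse = ⊕-inverseˡ , λ x → trans (⊕-comm x (⊝ x)) (⊕-inverseˡ x)
          ; ⁻¹-cong = cong ⊝_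
          }
        ; comm = ⊕-comm
        }
      ; *-cong = cong₂ _⊗_
      ; *-assoc = ⊗-assoc
      ; *-identity = ⊗-identityˡ , λ x → trans (⊗-comm x 𝟙) (⊗-identityˡ x)
      ; distrib = (λ x y z → trans (⊗-comm x (y ⊕ z))
                               (trans (⊗-distribʳ-⊕ x y z) (cong₂ _⊕_ (⊗-comm y x) (⊗-comm z x))))
                , ⊗-distribʳ-⊕
      }
    ; *-comm = ⊗-comm
    }
  }

-- Lets the ring solver take its coefficients in ℤ[φ] itself, so that φ² = φ + 1 is applied by
-- evaluating constants.
_≟φ_ : (x y : ℤ[φ]) → Dec (x ≡ y)
(p +φ q) ≟φ (r +φ s) with p ℤ.≟ r | q ℤ.≟ s
... | yes refl | yes refl = yes refl
... | no p≢r   | _        = no λ { refl → p≢r refl }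
... | yes _    | no q≢s   = no λ { refl → q≢s refl }

open import Algebra.Solver.Ring.Simple (fromCommutativeRing ℤ[φ]-commutativeRing) _≟φ_
  using (solve; _:=_; con; _:+_; _:*_; :-_)

-- The order that ℤ[φ] inherits from the reals.

-- The conjugate of φ has absolute value < 1, so a real number p + q φ is nonnegative
-- iff its product with some power of φ has nonnegative coefficients.
data Nonneg : ℤ[φ] → Set where
  coeffs≥0 : ∀ {p q} → 0ℤ ℤ.≤ p → 0ℤ ℤ.≤ q → Nonneg (p +φ q)
  φ-shift  : ∀ {p q} → Nonneg (q +φ p ℤ.+ q) → Nonneg (p +φ q)

nonneg-shift : ∀ {p q} → Nonneg (p +φ q) → Nonneg (q +φ p ℤ.+ q)
nonneg-shift (coeffs≥0 0≤p 0≤q) = coeffs≥0 0≤q (ℤ.+-mono-≤ 0≤p 0≤q)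
nonneg-shift (φ-shift n)        = n

φ⊗≡ : ∀ p q → φ ⊗ (p +φ q) ≡ (q +φ p ℤ.+ q)
φ⊗≡ p q = cong₂ _+φ_ (re-shift p q) (im-shift p q)
  where
  re-shift : ∀ p q → 0ℤ ℤ.* p ℤ.+ 1ℤ ℤ.* q ≡ q
  re-shift = solve-∀
  im-shift : ∀ p q → 0ℤ ℤ.* q ℤ.+ 1ℤ ℤ.* p ℤ.+ 1ℤ ℤ.* q ≡ p ℤ.+ q
  im-shift = solve-∀

nonneg-φ⊗ : ∀ {z} → Nonneg z → Nonneg (φ ⊗ z)
nonneg-φ⊗ {p +φ q} n = subst Nonneg (sym (φ⊗≡ p q)) (nonneg-shift n)

nonneg-⊕-shifted : ∀ p q r s → Nonneg ((q ℤ.+ s) +φ (p ℤ.+ q) ℤ.+ (r ℤ.+ s)) →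
  Nonneg ((p +φ q) ⊕ (r +φ s))
nonneg-⊕-shifted p q r s n = φ-shift (subst (λ i → Nonneg (_ +φ i)) (interchange p q r s) n)
  where
  interchange : ∀ p q r s → (p ℤ.+ q) ℤ.+ (r ℤ.+ s) ≡ (p ℤ.+ r) ℤ.+ (q ℤ.+ s)
  interchange = solve-∀

-- Induction on the number of shifts in the second summand; a shift keeps nonnegative coefficients
-- nonnegative, so the first summand can be shifted along.
nonneg-⊕-coeffs : ∀ {p q z} → 0ℤ ℤ.≤ p → 0ℤ ℤ.≤ q → Nonneg z → Nonneg ((p +φ q) ⊕ z)
nonneg-⊕-coeffs 0≤p 0≤q (coeffs≥0 0≤r 0≤s) = coeffs≥0 (ℤ.+-mono-≤ 0≤p 0≤r) (ℤ.+-mono-≤ 0≤q 0≤s)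
nonneg-⊕-coeffs {p} {q} 0≤p 0≤q (φ-shift {r} {s} n) =
  nonneg-⊕-shifted p q r s (nonneg-⊕-coeffs 0≤q (ℤ.+-mono-≤ 0≤p 0≤q) n)

nonneg-⊕ : ∀ {y z} → Nonneg y → Nonneg z → Nonneg (y ⊕ z)
nonneg-⊕ (coeffs≥0 0≤p 0≤q) n = nonneg-⊕-coeffs 0≤p 0≤q n
nonneg-⊕ {p +φ q} {r +φ s} (φ-shift m) n = nonneg-⊕-shifted p q r s (nonneg-⊕ m (nonneg-shift n))

-- Multiplication by −φ maps p − q φ to q − (p − q) φ: the totality proof is the Euclidean algorithm.
nonneg-total-opposite : ∀ b p q → p + q ≤ b →
  Nonneg (+ p +φ ℤ.- (+ q)) ⊎ Nonneg (ℤ.- (+ p) +φ + q)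
nonneg-total-opposite _ p zero _ = inj₁ (coeffs≥0 (+≤+ z≤n) (+≤+ z≤n))
nonneg-total-opposite zero p (suc q) p+q≤0 with () ← subst (_≤ 0) (ℕ.+-suc p q) p+q≤0
nonneg-total-opposite (suc b) p (suc q) p+q≤b with ℕ.≤-total p (suc q)
... | inj₁ p≤q = inj₂ (φ-shift (coeffs≥0 (+≤+ z≤n)
      (subst (0ℤ ℤ.≤_) (ℤ.+-comm (+ suc q) (ℤ.- + p)) (ℤ.i≤j⇒0≤j-i (+≤+ p≤q)))))
... | inj₂ q≤p with nonneg-total-opposite b (suc q) (p ∸ suc q) bound
  where
  bound : suc q + (p ∸ suc q) ≤ b
  bound = subst (_≤ b) (sym (ℕ.m+[n∸m]≡n q≤p))
            (ℕ.≤-trans (ℕ.m≤m+n p q) (ℕ.≤-pred (subst (_≤ suc b) (ℕ.+-suc p q) p+q≤b)))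
... | inj₁ n = inj₂ (φ-shift (subst (λ i → Nonneg (+ suc q +φ i)) eq n))
  where
  eq : ℤ.- (+ (p ∸ suc q)) ≡ ℤ.- (+ p) ℤ.+ + suc q
  eq = trans (cong ℤ.-_ (sym (trans (ℤ.m-n≡m⊖n p (suc q)) (ℤ.⊖-≥ q≤p))))
         (neg-diff (+ p) (+ suc q))
    where
    neg-diff : ∀ i j → ℤ.- (i ℤ.- j) ≡ ℤ.- i ℤ.+ j
    neg-diff = solve-∀
... | inj₂ n = inj₁ (φ-shift (subst (λ i → Nonneg (ℤ.- (+ suc q) +φ i)) eq n))
  where
  eq : + (p ∸ suc q) ≡ + p ℤ.+ ℤ.- (+ suc q)
  eq = sym (trans (ℤ.m-n≡m⊖n p (suc q)) (ℤ.⊖-≥ q≤p))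

nonneg-total : ∀ z → Nonneg z ⊎ Nonneg (⊝ z)
nonneg-total (+ p +φ + q)               = inj₁ (coeffs≥0 (+≤+ z≤n) (+≤+ z≤n))
nonneg-total (+ p +φ -[1+ q ])          = nonneg-total-opposite _ p (suc q) ℕ.≤-refl
nonneg-total (-[1+ p ] +φ + q)          = Sum.swap (nonneg-total-opposite _ (suc p) q ℕ.≤-refl)
nonneg-total (-[1+ p ] +φ -[1+ q ])     = inj₂ (coeffs≥0 (+≤+ z≤n) (+≤+ z≤n))

-- Norms, and the order in terms of integer inequalities.

*-nonneg : ∀ {i j} → 0ℤ ℤ.≤ i → 0ℤ ℤ.≤ j → 0ℤ ℤ.≤ i ℤ.* j
*-nonneg {+ m} {+ n} _ _ = subst (0ℤ ℤ.≤_) (ℤ.pos-* m n) (+≤+ z≤n)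

-- The product of p + q φ with its algebraic conjugate.
norm : ℤ → ℤ → ℤ
norm p q = p ℤ.* p ℤ.+ p ℤ.* q ℤ.- q ℤ.* q

-- A shift is multiplication by φ, and φ has norm -1.
norm-shift : ∀ p q → norm q (p ℤ.+ q) ≡ ℤ.- norm p q
norm-shift = unfolded
  where
  unfolded : ∀ p q → q ℤ.* q ℤ.+ q ℤ.* (p ℤ.+ q) ℤ.- (p ℤ.+ q) ℤ.* (p ℤ.+ q)
    ≡ ℤ.- (p ℤ.* p ℤ.+ p ℤ.* q ℤ.- q ℤ.* q)
  unfolded = solve-∀

-- These two lemmas turn a sign in ℤ[φ] into quadratic integer inequalities. The induction is mutual
-- because a shift makes the old φ-coefficient the new integer part and negates the norm.
nonneg-im≤0 : ∀ {p q} → Nonneg (p +φ q) → q ℤ.≤ 0ℤ → 0ℤ ℤ.≤ p ℤ.+ q × 0ℤ ℤ.≤ norm p q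
nonneg-re≤0 : ∀ {p q} → Nonneg (p +φ q) → p ℤ.≤ 0ℤ → 0ℤ ℤ.≤ q × norm p q ℤ.≤ 0ℤ

nonneg-im≤0 {p} {q} (coeffs≥0 0≤p 0≤q) q≤0 with refl ← ℤ.≤-antisym q≤0 0≤q =
  subst (0ℤ ℤ.≤_) (sym (ℤ.+-identityʳ p)) 0≤p ,
  subst (0ℤ ℤ.≤_) (square p) (*-nonneg 0≤p 0≤p)
  where
  square : ∀ p → p ℤ.* p ≡ p ℤ.* p ℤ.+ p ℤ.* 0ℤ ℤ.- 0ℤ
  square = solve-∀
nonneg-im≤0 {p} {q} (φ-shift n) q≤0 with nonneg-re≤0 n q≤0
... | 0≤p+q , norm≤0 =
  0≤p+q , ℤ.neg-cancel-≤ (subst (ℤ._≤ 0ℤ) (norm-shift p q) norm≤0)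

nonneg-re≤0 {p} {q} (coeffs≥0 0≤p 0≤q) p≤0 with refl ← ℤ.≤-antisym p≤0 0≤p =
  0≤q , subst (ℤ._≤ 0ℤ) (square q) (ℤ.neg-mono-≤ (*-nonneg 0≤q 0≤q))
  where
  square : ∀ q → ℤ.- (q ℤ.* q) ≡ 0ℤ ℤ.+ 0ℤ ℤ.* q ℤ.- q ℤ.* q
  square = solve-∀
-- If 0 ≤ p + q, the norm is -((-p)(p + q) + q²) and its sign is visible. Otherwise the shifted
-- number has a φ-coefficient ≤ 0 and the companion lemma applies to it.
nonneg-re≤0 {p} {q} (φ-shift n) p≤0 with ℤ.≤-total 0ℤ (p ℤ.+ q)
... | inj₁ 0≤p+q = 0≤q , norm≤0
  where
  -p≥0 : 0ℤ ℤ.≤ ℤ.- p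
  -p≥0 = ℤ.neg-mono-≤ p≤0
  cancel : ∀ p q → ℤ.- p ℤ.+ (p ℤ.+ q) ≡ q
  cancel = solve-∀
  0≤q : 0ℤ ℤ.≤ q
  0≤q = subst (0ℤ ℤ.≤_) (cancel p q) (ℤ.+-mono-≤ -p≥0 0≤p+q)
  factor : ∀ p q → ℤ.- (ℤ.- p ℤ.* (p ℤ.+ q) ℤ.+ q ℤ.* q) ≡ p ℤ.* p ℤ.+ p ℤ.* q ℤ.- q ℤ.* q
  factor = solve-∀
  norm≤0 : norm p q ℤ.≤ 0ℤ
  norm≤0 = subst (ℤ._≤ 0ℤ) (factor p q)
    (ℤ.neg-mono-≤ (ℤ.+-mono-≤ (*-nonneg -p≥0 0≤p+q) (*-nonneg 0≤q 0≤q)))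
... | inj₂ p+q≤0 with nonneg-im≤0 n p+q≤0
...   | 0≤q+p+q , 0≤norm =
  0≤q , ℤ.neg-cancel-≤ (subst (0ℤ ℤ.≤_) (norm-shift p q) 0≤norm)
  where
  cancel : ∀ p q → (q ℤ.+ (p ℤ.+ q)) ℤ.+ ℤ.- (p ℤ.+ q) ≡ q
  cancel = solve-∀
  0≤q : 0ℤ ℤ.≤ q
  0≤q = subst (0ℤ ℤ.≤_) (cancel p q) (ℤ.+-mono-≤ 0≤q+p+q (ℤ.neg-mono-≤ p+q≤0))

-- c ≥ φ a means 2c - a ≥ √5 a. After squaring, the difference (2c - a)² - 5a² is four times the
-- norm of c - a φ.
nonneg⇒Sqrt5MulLe : ∀ {a c} → 0ℤ ℤ.≤ a → Nonneg (c +φ ℤ.- a) → Sqrt5MulLe a (+ 2 ℤ.* c ℤ.- a)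
nonneg⇒Sqrt5MulLe {a} {c} 0≤a n =
  (λ _ → subst (0ℤ ℤ.≤_) (linear a c) (ℤ.+-mono-≤ (ℤ.+-mono-≤ c≥a c≥a) 0≤a) ,
         ℤ.0≤i-j⇒j≤i (subst (0ℤ ℤ.≤_) (quadratic a c) (*-nonneg {+ 4} (+≤+ z≤n) norm≥0))) ,
  (λ a<0 → contradiction a<0 (ℤ.≤⇒≯ 0≤a))
  where
  c≥a : 0ℤ ℤ.≤ c ℤ.+ ℤ.- a
  c≥a = proj₁ (nonneg-im≤0 n (ℤ.neg-mono-≤ 0≤a))
  norm≥0 : 0ℤ ℤ.≤ norm c (ℤ.- a)
  norm≥0 = proj₂ (nonneg-im≤0 n (ℤ.neg-mono-≤ 0≤a))
  linear : ∀ a c → (c ℤ.- a) ℤ.+ (c ℤ.- a) ℤ.+ a ≡ + 2 ℤ.* c ℤ.- a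
  linear = solve-∀
  quadratic : ∀ a c →
    + 4 ℤ.* (c ℤ.* c ℤ.+ c ℤ.* (ℤ.- a) ℤ.- (ℤ.- a) ℤ.* (ℤ.- a))
    ≡ (+ 2 ℤ.* c ℤ.- a) ℤ.* (+ 2 ℤ.* c ℤ.- a) ℤ.- + 5 ℤ.* (a ℤ.* a)
  quadratic = solve-∀

-- The invariant of a component and its behaviour under merging.

√5 : ℤ[φ]
√5 = (ℤ.- 1ℤ) +φ (+ 2)

record Good (S T : ℤ[φ]) : Set where
  field
    S≥-√5   : Nonneg (S ⊕ √5)
    T≥-√5   : Nonneg (T ⊕ √5)
    S+φT≥-φ : Nonneg (S ⊕ φ ⊗ T ⊕ φ)
    T+φS≥-φ : Nonneg (T ⊕ φ ⊗ S ⊕ φ)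

open Good

good-swap : ∀ {S T} → Good S T → Good T S
good-swap g = record { S≥-√5 = T≥-√5 g ; T≥-√5 = S≥-√5 g ; S+φT≥-φ = T+φS≥-φ g ; T+φS≥-φ = S+φT≥-φ g }

nonneg-𝟙 : Nonneg 𝟙
nonneg-𝟙 = coeffs≥0 (+≤+ z≤n) (+≤+ z≤n)

nonneg-φ : Nonneg φ
nonneg-φ = coeffs≥0 (+≤+ z≤n) (+≤+ z≤n)

-- All four conditions are monotone in both slacks, because φ > 0.
good-mono : ∀ {S T x y} → Nonneg x → Nonneg y → Good S T → Good (S ⊕ x) (T ⊕ y)
good-mono {S} {T} {x} {y} x≥0 y≥0 g = record
  { S≥-√5   = subst Nonneg (shift S x √5) (nonneg-⊕ (S≥-√5 g) x≥0)
  ; T≥-√5   = subst Nonneg (shift T y √5) (nonneg-⊕ (T≥-√5 g) y≥0)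
  ; S+φT≥-φ = subst Nonneg (skew S T x y) (nonneg-⊕ (S+φT≥-φ g) (nonneg-⊕ x≥0 (nonneg-φ⊗ y≥0)))
  ; T+φS≥-φ = subst Nonneg (skew T S y x) (nonneg-⊕ (T+φS≥-φ g) (nonneg-⊕ y≥0 (nonneg-φ⊗ x≥0)))
  }
  where
  shift : ∀ S x c → S ⊕ c ⊕ x ≡ S ⊕ x ⊕ c
  shift = solve 3 (λ S x c → S :+ c :+ x := S :+ x :+ c) refl
  skew : ∀ S T x y → (S ⊕ φ ⊗ T ⊕ φ) ⊕ (x ⊕ φ ⊗ y) ≡ (S ⊕ x) ⊕ φ ⊗ (T ⊕ y) ⊕ φ
  skew = solve 4 (λ S T x y → (S :+ con φ :* T :+ con φ) :+ (x :+ con φ :* y)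
    := (S :+ x) :+ con φ :* (T :+ y) :+ con φ) refl

-- `S₁` and `S₂` belong to the sides containing the endpoints of the new edge. Being a record, the
-- type determines its four parameters, which the sums alone would not.
record BlueMerge (S₁ T₁ S₂ T₂ : ℤ[φ]) : Set where
  constructor blueMerge
  field merged : Good (S₁ ⊕ S₂) (T₁ ⊕ T₂ ⊕ 𝟙)

record RedMerge (S₁ T₁ S₂ T₂ : ℤ[φ]) : Set where
  constructor redMerge
  field merged : Good (S₁ ⊕ T₂ ⊕ 𝟙) (T₁ ⊕ S₂ ⊕ 𝟙)

-- The last hypothesis says that red would bring the second slack down to -√5 or below. By φ² = φ +
-- 1, each condition for blue is a combination, with coefficients among 1, φ and φ², of this
-- hypothesis and the old conditions, up to a spare 1. In `eq₃` the two old bounds -2φ and the φ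
-- earned by the new edge balance exactly.
blueMerge-good : ∀ {S₁ T₁ S₂ T₂} → Good S₁ T₁ → Good S₂ T₂ →
  Nonneg (⊝ (T₁ ⊕ S₂ ⊕ 𝟙 ⊕ √5)) → BlueMerge S₁ T₁ S₂ T₂
blueMerge-good {S₁} {T₁} {S₂} {T₂} g₁ g₂ d = blueMerge record
  { S≥-√5   = subst Nonneg (eq₁ S₁ T₁ S₂ T₂)
      (nonneg-⊕ (nonneg-⊕ (S+φT≥-φ g₁) (nonneg-φ⊗ d)) (nonneg-φ⊗ (nonneg-φ⊗ (S≥-√5 g₂))))
  ; T≥-√5   = subst Nonneg (eq₂ S₁ T₁ S₂ T₂)
      (nonneg-⊕ (nonneg-⊕ (nonneg-⊕ (T+φS≥-φ g₂) (nonneg-φ⊗ d)) (nonneg-φ⊗ (nonneg-φ⊗ (T≥-√5 g₁)))) nonneg-𝟙)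
  ; S+φT≥-φ = subst Nonneg (eq₃ S₁ T₁ S₂ T₂) (nonneg-⊕ (S+φT≥-φ g₁) (S+φT≥-φ g₂))
  ; T+φS≥-φ = subst Nonneg (eq₄ S₁ T₁ S₂ T₂)
      (nonneg-⊕ (nonneg-⊕ (nonneg-⊕ (nonneg-φ⊗ (S+φT≥-φ g₁)) (T+φS≥-φ g₂)) (nonneg-φ⊗ d)) (nonneg-φ⊗ (S≥-√5 g₂)))
  }
  where
  eq₁ : ∀ S₁ T₁ S₂ T₂ →
    (S₁ ⊕ φ ⊗ T₁ ⊕ φ) ⊕ φ ⊗ (⊝ (T₁ ⊕ S₂ ⊕ 𝟙 ⊕ √5)) ⊕ φ ⊗ (φ ⊗ (S₂ ⊕ √5)) ≡ S₁ ⊕ S₂ ⊕ √5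
  eq₁ = solve 4 (λ S₁ T₁ S₂ T₂ →
    (S₁ :+ con φ :* T₁ :+ con φ) :+ con φ :* (:- (T₁ :+ S₂ :+ con 𝟙 :+ con √5)) :+ con φ :* (con φ :* (S₂ :+ con √5))
    := S₁ :+ S₂ :+ con √5) refl
  eq₂ : ∀ S₁ T₁ S₂ T₂ →
    (T₂ ⊕ φ ⊗ S₂ ⊕ φ) ⊕ φ ⊗ (⊝ (T₁ ⊕ S₂ ⊕ 𝟙 ⊕ √5)) ⊕ φ ⊗ (φ ⊗ (T₁ ⊕ √5)) ⊕ 𝟙 ≡ T₁ ⊕ T₂ ⊕ 𝟙 ⊕ √5
  eq₂ = solve 4 (λ S₁ T₁ S₂ T₂ →
    (T₂ :+ con φ :* S₂ :+ con φ) :+ con φ :* (:- (T₁ :+ S₂ :+ con 𝟙 :+ con √5)) :+ con φ :* (con φ :* (T₁ :+ con √5)) :+ con 𝟙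
    := T₁ :+ T₂ :+ con 𝟙 :+ con √5) refl
  eq₃ : ∀ S₁ T₁ S₂ T₂ →
    (S₁ ⊕ φ ⊗ T₁ ⊕ φ) ⊕ (S₂ ⊕ φ ⊗ T₂ ⊕ φ) ≡ (S₁ ⊕ S₂) ⊕ φ ⊗ (T₁ ⊕ T₂ ⊕ 𝟙) ⊕ φ
  eq₃ = solve 4 (λ S₁ T₁ S₂ T₂ →
    (S₁ :+ con φ :* T₁ :+ con φ) :+ (S₂ :+ con φ :* T₂ :+ con φ)
    := (S₁ :+ S₂) :+ con φ :* (T₁ :+ T₂ :+ con 𝟙) :+ con φ) refl
  eq₄ : ∀ S₁ T₁ S₂ T₂ →
    φ ⊗ (S₁ ⊕ φ ⊗ T₁ ⊕ φ) ⊕ (T₂ ⊕ φ ⊗ S₂ ⊕ φ) ⊕ φ ⊗ (⊝ (T₁ ⊕ S₂ ⊕ 𝟙 ⊕ √5)) ⊕ φ ⊗ (S₂ ⊕ √5)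
    ≡ (T₁ ⊕ T₂ ⊕ 𝟙) ⊕ φ ⊗ (S₁ ⊕ S₂) ⊕ φ
  eq₄ = solve 4 (λ S₁ T₁ S₂ T₂ →
    con φ :* (S₁ :+ con φ :* T₁ :+ con φ) :+ (T₂ :+ con φ :* S₂ :+ con φ) :+ con φ :* (:- (T₁ :+ S₂ :+ con 𝟙 :+ con √5)) :+ con φ :* (S₂ :+ con √5)
    := (T₁ :+ T₂ :+ con 𝟙) :+ con φ :* (S₁ :+ S₂) :+ con φ) refl

-- The mixed conditions come for free: two old ones add up to -2φ, and the red edge earns 1 + φ.
redMerge-good : ∀ {S₁ T₁ S₂ T₂} → Good S₁ T₁ → Good S₂ T₂ →
  Nonneg (T₁ ⊕ S₂ ⊕ 𝟙 ⊕ √5) → Nonneg (S₁ ⊕ T₂ ⊕ 𝟙 ⊕ √5) → RedMerge S₁ T₁ S₂ T₂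
redMerge-good {S₁} {T₁} {S₂} {T₂} g₁ g₂ d e = redMerge record
  { S≥-√5   = e
  ; T≥-√5   = d
  ; S+φT≥-φ = subst Nonneg (skew S₁ T₁ S₂ T₂) (nonneg-⊕ (nonneg-⊕ (S+φT≥-φ g₁) (T+φS≥-φ g₂)) nonneg-𝟙)
  ; T+φS≥-φ = subst Nonneg (skew T₁ S₁ T₂ S₂) (nonneg-⊕ (nonneg-⊕ (T+φS≥-φ g₁) (S+φT≥-φ g₂)) nonneg-𝟙)
  }
  where
  skew : ∀ S₁ T₁ S₂ T₂ →
    (S₁ ⊕ φ ⊗ T₁ ⊕ φ) ⊕ (T₂ ⊕ φ ⊗ S₂ ⊕ φ) ⊕ 𝟙 ≡ (S₁ ⊕ T₂ ⊕ 𝟙) ⊕ φ ⊗ (T₁ ⊕ S₂ ⊕ 𝟙) ⊕ φ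
  skew = solve 4 (λ S₁ T₁ S₂ T₂ →
    (S₁ :+ con φ :* T₁ :+ con φ) :+ (T₂ :+ con φ :* S₂ :+ con φ) :+ con 𝟙
    := (S₁ :+ T₂ :+ con 𝟙) :+ con φ :* (T₁ :+ S₂ :+ con 𝟙) :+ con φ) refl

blueMerge-comm : ∀ {S₁ T₁ S₂ T₂} → BlueMerge S₁ T₁ S₂ T₂ → BlueMerge S₂ T₂ S₁ T₁
blueMerge-comm {S₁} {T₁} {S₂} {T₂} (blueMerge g) =
  blueMerge (subst₂ Good (⊕-comm S₁ S₂) (cong (_⊕ 𝟙) (⊕-comm T₁ T₂)) g)

redMerge-comm : ∀ {S₁ T₁ S₂ T₂} → RedMerge S₁ T₁ S₂ T₂ → RedMerge S₂ T₂ S₁ T₁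
redMerge-comm {S₁} {T₁} {S₂} {T₂} (redMerge g) =
  redMerge (subst₂ Good (cong (_⊕ 𝟙) (⊕-comm T₁ S₂)) (cong (_⊕ 𝟙) (⊕-comm S₁ T₂)) (good-swap g))

-- Red can fail only through one of the two bounds -√5, and exchanging the components exchanges
-- these bounds.
merge-good : ∀ {S₁ T₁ S₂ T₂} → Good S₁ T₁ → Good S₂ T₂ →
  BlueMerge S₁ T₁ S₂ T₂ ⊎ RedMerge S₁ T₁ S₂ T₂
merge-good {S₁} {T₁} {S₂} {T₂} g₁ g₂ with nonneg-total (T₁ ⊕ S₂ ⊕ 𝟙 ⊕ √5) | nonneg-total (T₂ ⊕ S₁ ⊕ 𝟙 ⊕ √5)
... | inj₂ d | _      = inj₁ (blueMerge-good g₁ g₂ d)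
... | inj₁ _ | inj₂ e = inj₁ (blueMerge-comm (blueMerge-good g₂ g₁ e))
... | inj₁ d | inj₁ e =
  inj₂ (redMerge-good g₁ g₂ d (subst (λ z → Nonneg (z ⊕ 𝟙 ⊕ √5)) (⊕-comm T₂ S₁) e))

merge-single : ∀ {S T} → Good S T → BlueMerge S T (⊝ φ) 𝟘 ⊎ RedMerge S T (⊝ φ) 𝟘
-- Red makes the second slack T - φ + 1; since √5 = 2φ - 1, the demand that it be at least -√5 reads
-- T ≥ -φ.
merge-single {S} {T} g with nonneg-total (T ⊕ φ)
... | inj₁ d = inj₂ (redMerge record
  { S≥-√5   = subst Nonneg (eq₁ S) (nonneg-⊕ (S≥-√5 g) nonneg-𝟙)
  ; T≥-√5   = subst Nonneg (eq₂ T) d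
  ; S+φT≥-φ = subst Nonneg (eq₃ S T) (S+φT≥-φ g)
  ; T+φS≥-φ = subst Nonneg (eq₄ S T) (nonneg-⊕ (T+φS≥-φ g) nonneg-𝟙)
  })
  where
  eq₁ : ∀ S → S ⊕ √5 ⊕ 𝟙 ≡ S ⊕ 𝟘 ⊕ 𝟙 ⊕ √5
  eq₁ = solve 1 (λ S → S :+ con √5 :+ con 𝟙 := S :+ con 𝟘 :+ con 𝟙 :+ con √5) refl
  eq₂ : ∀ T → T ⊕ φ ≡ T ⊕ ⊝ φ ⊕ 𝟙 ⊕ √5
  eq₂ = solve 1 (λ T → T :+ con φ := T :+ :- con φ :+ con 𝟙 :+ con √5) refl
  eq₃ : ∀ S T → S ⊕ φ ⊗ T ⊕ φ ≡ (S ⊕ 𝟘 ⊕ 𝟙) ⊕ φ ⊗ (T ⊕ ⊝ φ ⊕ 𝟙) ⊕ φ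
  eq₃ = solve 2 (λ S T → S :+ con φ :* T :+ con φ
    := (S :+ con 𝟘 :+ con 𝟙) :+ con φ :* (T :+ :- con φ :+ con 𝟙) :+ con φ) refl
  eq₄ : ∀ S T → (T ⊕ φ ⊗ S ⊕ φ) ⊕ 𝟙 ≡ (T ⊕ ⊝ φ ⊕ 𝟙) ⊕ φ ⊗ (S ⊕ 𝟘 ⊕ 𝟙) ⊕ φ
  eq₄ = solve 2 (λ S T → (T :+ con φ :* S :+ con φ) :+ con 𝟙
    := (T :+ :- con φ :+ con 𝟙) :+ con φ :* (S :+ con 𝟘 :+ con 𝟙) :+ con φ) refl
... | inj₂ d = inj₁ (blueMerge record
  { S≥-√5   = subst Nonneg (eq₁ S T) (nonneg-⊕ (nonneg-⊕ (S+φT≥-φ g) (nonneg-φ⊗ d)) nonneg-φ)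
  ; T≥-√5   = subst Nonneg (eq₂ T) (nonneg-⊕ (T≥-√5 g) nonneg-𝟙)
  ; S+φT≥-φ = subst Nonneg (eq₃ S T) (S+φT≥-φ g)
  ; T+φS≥-φ = subst Nonneg (eq₄ S T) (nonneg-⊕ (nonneg-φ⊗ (S+φT≥-φ g)) (nonneg-φ⊗ d))
  })
  where
  eq₁ : ∀ S T → (S ⊕ φ ⊗ T ⊕ φ) ⊕ φ ⊗ (⊝ (T ⊕ φ)) ⊕ φ ≡ S ⊕ ⊝ φ ⊕ √5
  eq₁ = solve 2 (λ S T → (S :+ con φ :* T :+ con φ) :+ con φ :* (:- (T :+ con φ)) :+ con φ
    := S :+ :- con φ :+ con √5) refl
  eq₂ : ∀ T → T ⊕ √5 ⊕ 𝟙 ≡ T ⊕ 𝟘 ⊕ 𝟙 ⊕ √5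
  eq₂ = solve 1 (λ T → T :+ con √5 :+ con 𝟙 := T :+ con 𝟘 :+ con 𝟙 :+ con √5) refl
  eq₃ : ∀ S T → S ⊕ φ ⊗ T ⊕ φ ≡ (S ⊕ ⊝ φ) ⊕ φ ⊗ (T ⊕ 𝟘 ⊕ 𝟙) ⊕ φ
  eq₃ = solve 2 (λ S T → S :+ con φ :* T :+ con φ
    := (S :+ :- con φ) :+ con φ :* (T :+ con 𝟘 :+ con 𝟙) :+ con φ) refl
  eq₄ : ∀ S T → φ ⊗ (S ⊕ φ ⊗ T ⊕ φ) ⊕ φ ⊗ (⊝ (T ⊕ φ)) ≡ (T ⊕ 𝟘 ⊕ 𝟙) ⊕ φ ⊗ (S ⊕ ⊝ φ) ⊕ φ
  eq₄ = solve 2 (λ S T → con φ :* (S :+ con φ :* T :+ con φ) :+ con φ :* (:- (T :+ con φ))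
    := (T :+ con 𝟘 :+ con 𝟙) :+ con φ :* (S :+ :- con φ) :+ con φ) refl

-- Blue is impossible here, as it gives S = -2φ < -√5. Red makes both slacks 1 - φ, and the mixed
-- conditions hold with equality.
redMerge-single-single : RedMerge (⊝ φ) 𝟘 (⊝ φ) 𝟘
redMerge-single-single = redMerge record
  { S≥-√5   = coeffs≥0 (+≤+ z≤n) (+≤+ z≤n)
  ; T≥-√5   = coeffs≥0 (+≤+ z≤n) (+≤+ z≤n)
  ; S+φT≥-φ = coeffs≥0 (+≤+ z≤n) (+≤+ z≤n)
  ; T+φS≥-φ = coeffs≥0 (+≤+ z≤n) (+≤+ z≤n)
  }

-- A one-vertex component has S = −φ and T = 0, which violates T + φ S ≥ −φ.
data Viable (S T : ℤ[φ]) : Set where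
  good   : Good S T → Viable S T
  single : Nonneg (S ⊕ φ) → Nonneg T → Viable S T

-- Carries `merge-single` from the exact slacks -φ and 0 to all larger ones.
blueMerge-mono : ∀ {S₁ T₁ S₂ T₂} → Nonneg (S₂ ⊕ φ) → Nonneg T₂ →
  BlueMerge S₁ T₁ (⊝ φ) 𝟘 → BlueMerge S₁ T₁ S₂ T₂
blueMerge-mono {S₁} {T₁} {S₂} {T₂} x y (blueMerge g) =
  blueMerge (subst₂ Good (eq₁ S₁ S₂) (eq₂ T₁ T₂) (good-mono x y g))
  where
  eq₁ : ∀ S₁ S₂ → S₁ ⊕ ⊝ φ ⊕ (S₂ ⊕ φ) ≡ S₁ ⊕ S₂
  eq₁ = solve 2 (λ S₁ S₂ → S₁ :+ :- con φ :+ (S₂ :+ con φ) := S₁ :+ S₂) refl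
  eq₂ : ∀ T₁ T₂ → T₁ ⊕ 𝟘 ⊕ 𝟙 ⊕ T₂ ≡ T₁ ⊕ T₂ ⊕ 𝟙
  eq₂ = solve 2 (λ T₁ T₂ → T₁ :+ con 𝟘 :+ con 𝟙 :+ T₂ := T₁ :+ T₂ :+ con 𝟙) refl

redMerge-mono : ∀ {S₁ T₁ S₂ T₂} → Nonneg (S₂ ⊕ φ) → Nonneg T₂ →
  RedMerge S₁ T₁ (⊝ φ) 𝟘 → RedMerge S₁ T₁ S₂ T₂
redMerge-mono {S₁} {T₁} {S₂} {T₂} x y (redMerge g) =
  redMerge (subst₂ Good (eq₁ S₁ T₂) (eq₂ T₁ S₂) (good-mono y x g))
  where
  eq₁ : ∀ S₁ T₂ → S₁ ⊕ 𝟘 ⊕ 𝟙 ⊕ T₂ ≡ S₁ ⊕ T₂ ⊕ 𝟙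
  eq₁ = solve 2 (λ S₁ T₂ → S₁ :+ con 𝟘 :+ con 𝟙 :+ T₂ := S₁ :+ T₂ :+ con 𝟙) refl
  eq₂ : ∀ T₁ S₂ → T₁ ⊕ ⊝ φ ⊕ 𝟙 ⊕ (S₂ ⊕ φ) ≡ T₁ ⊕ S₂ ⊕ 𝟙
  eq₂ = solve 2 (λ T₁ S₂ → T₁ :+ :- con φ :+ con 𝟙 :+ (S₂ :+ con φ) := T₁ :+ S₂ :+ con 𝟙) refl

merge-viable : ∀ {S₁ T₁ S₂ T₂} → Viable S₁ T₁ → Viable S₂ T₂ →
  BlueMerge S₁ T₁ S₂ T₂ ⊎ RedMerge S₁ T₁ S₂ T₂
merge-viable (good g₁) (good g₂) = merge-good g₁ g₂
merge-viable (good g) (single x y) = Sum.map (blueMerge-mono x y) (redMerge-mono x y) (merge-single g)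
merge-viable (single x y) (good g) =
  Sum.map (λ m → blueMerge-comm (blueMerge-mono x y m)) (λ m → redMerge-comm (redMerge-mono x y m)) (merge-single g)
merge-viable (single x₁ y₁) (single x₂ y₂) =
  inj₂ (redMerge-mono x₂ y₂ (redMerge-comm (redMerge-mono x₁ y₁ redMerge-single-single)))

-- Slacks as numbers of ℤ[φ], and the golden bound.

ι : ℕ → ℤ[φ]
ι n = + n +φ 0ℤ

nonneg-ι : ∀ n → Nonneg (ι n)
nonneg-ι n = coeffs≥0 (+≤+ z≤n) (+≤+ z≤n)

potential : ℕ → ℕ → ℤ[φ]
potential x a = + x +φ ℤ.- (+ a)

potential-+ : ∀ x₁ a₁ x₂ a₂ → potential (x₁ + x₂) (a₁ + a₂) ≡ potential x₁ a₁ ⊕ potential x₂ a₂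
potential-+ x₁ a₁ x₂ a₂ = cong₂ _+φ_ refl (trans (cong ℤ.-_ (ℤ.pos-+ a₁ a₂)) (ℤ.neg-distrib-+ (+ a₁) (+ a₂)))

potential-ι : ∀ w x a → potential (w + x) a ≡ potential x a ⊕ ι w
potential-ι w x a = cong₂ _+φ_ (cong +_ (ℕ.+-comm w x)) (sym (ℤ.+-identityʳ _))

-- Adding (t - m - x) + (a - n) φ ≥ 0 to x - a φ + √5 ≥ 0 leaves (t - m - 1) - (n - 2) φ ≥ 0,
-- because √5 = 2φ - 1.
golden-bound : ∀ {n m t x a} → 2 ≤ n → n ≤ a → m + x ≤ t →
  Nonneg (potential x a ⊕ √5) → GoldenBoundLe n m t
golden-bound {n} {m} {t} {x} {a} 2≤n n≤a m+x≤t S≥ =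
  nonneg⇒Sqrt5MulLe (ℤ.i≤j⇒0≤j-i (+≤+ 2≤n))
    (subst Nonneg
      (cong₂ _+φ_
        (trans (cong (λ i → + x ℤ.+ ℤ.- 1ℤ ℤ.+ (+ t ℤ.- i)) (ℤ.pos-+ m x)) (re-eq (+ t) (+ m) (+ x)))
        (im-eq (+ n) (+ a)))
      (nonneg-⊕ S≥ (coeffs≥0 (ℤ.i≤j⇒0≤j-i (+≤+ m+x≤t)) (ℤ.i≤j⇒0≤j-i (+≤+ n≤a)))))
  where
  re-eq : ∀ t m x → x ℤ.+ ℤ.- 1ℤ ℤ.+ (t ℤ.- (m ℤ.+ x)) ≡ t ℤ.- m ℤ.- 1ℤ
  re-eq = solve-∀
  im-eq : ∀ n a → ℤ.- a ℤ.+ + 2 ℤ.+ (a ℤ.- n) ≡ ℤ.- (n ℤ.- + 2)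
  im-eq = solve-∀

-- Counting in lists.

injective-∈⇒≤ : ∀ {A : Set} {n} {f : Fin n → A} {xs : List A} →
  Injective _≡_ _≡_ f → (∀ i → f i ∈ xs) → n ≤ length xs
-- Distinct values sit at distinct positions of `xs`.
injective-∈⇒≤ f-inj f∈ = Fin.injective⇒≤ {f = λ i → index (f∈ i)}
  λ {i} {j} eq → f-inj (index-injective (setoid _) (f∈ i) (f∈ j) eq)

unique⇒lookup-injective : ∀ {A : Set} {xs : List A} → Unique xs → Injective _≡_ _≡_ (lookup xs)
unique⇒lookup-injective {xs = x ∷ xs} (x∉ ∷ u) {Fin.zero} {Fin.zero} _ = refl
unique⇒lookup-injective {xs = x ∷ xs} (x∉ ∷ u) {Fin.zero} {Fin.suc j} eq =
  contradiction eq (All.lookup x∉ (∈-lookup j))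
unique⇒lookup-injective {xs = x ∷ xs} (x∉ ∷ u) {Fin.suc i} {Fin.zero} eq =
  contradiction (sym eq) (All.lookup x∉ (∈-lookup i))
unique⇒lookup-injective {xs = x ∷ xs} (x∉ ∷ u) {Fin.suc i} {Fin.suc j} eq =
  cong Fin.suc (unique⇒lookup-injective u eq)

total : ∀ {A : Set} → (A → ℕ) → List A → ℕ
total w xs = sum (map w xs)

total-+ : ∀ {A : Set} {w w₁ w₂ : A → ℕ} → (∀ x → w x ≡ w₁ x + w₂ x) →
  ∀ xs → total w xs ≡ total w₁ xs + total w₂ xs
total-+ eq [] = refl
total-+ {w = w} {w₁} {w₂} eq (x ∷ xs) = begin
  w x + total w xs                              ≡⟨ cong₂ _+_ (eq x) (total-+ eq xs) ⟩
  (w₁ x + w₂ x) + (total w₁ xs + total w₂ xs)   ≡⟨ +-interchange (w₁ x) (w₂ x) (total w₁ xs) (total w₂ xs) ⟩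
  (w₁ x + total w₁ xs) + (w₂ x + total w₂ xs)   ∎
  where
  open ≡-Reasoning

total-cong : ∀ {A : Set} {w w′ : A → ℕ} → (∀ x → w x ≡ w′ x) → ∀ xs → total w xs ≡ total w′ xs
total-cong eq []       = refl
total-cong eq (x ∷ xs) = cong₂ _+_ (eq x) (total-cong eq xs)

-- A 0/1 weight splits the list. This later separates the edges of a blue copy from the edges
-- outside its side.
length-zeros+total≤length : ∀ {A : Set} {w : A → ℕ} → (∀ x → w x ≤ 1) →
  ∀ xs → length (filter (λ x → w x ≟ 0) xs) + total w xs ≤ length xs
length-zeros+total≤length w≤1 [] = z≤n
length-zeros+total≤length {w = w} w≤1 (x ∷ xs) with w x | w≤1 x
... | 0 | _ = s≤s (length-zeros+total≤length w≤1 xs)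
... | suc zero | _ = ℕ.≤-trans (ℕ.≤-reflexive (ℕ.+-suc _ _)) (s≤s (length-zeros+total≤length w≤1 xs))
... | suc (suc _) | s≤s ()

-- Colours and sides.

xor-involutive : ∀ f t → f xor (f xor t) ≡ t
xor-involutive false t     = refl
xor-involutive true  false = refl
xor-involutive true  true  = refl

-- The side on which an edge starting in side s must end.
crosses : Colour → Bool → Bool
crosses red  s = not s
crosses blue s = s

-- 1 if an edge of the given colour that starts in side t is not inside side s, else 0.
escapes : Colour → Bool → Bool → ℕ
escapes red  t s = 1
escapes blue t s = if t xor s then 1 else 0

-- Only the position of s relative to t matters, so a flip can move from one to the other.
escapes-xor : ∀ c f t s → escapes c (f xor t) s ≡ escapes c t (f xor s)
escapes-xor red  f t s = refl
escapes-xor blue false t s = refl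
escapes-xor blue true  false s = refl
escapes-xor blue true  true  false = refl
escapes-xor blue true  true  true  = refl

escapes≤1 : ∀ c t s → escapes c t s ≤ 1
escapes≤1 red t s = s≤s z≤n
escapes≤1 blue t s with t xor s
... | true = s≤s z≤n
... | false = z≤n

escapes-inside : ∀ s → escapes blue s s ≡ 0
escapes-inside false = refl
escapes-inside true  = refl

crosses-xor : ∀ c f s → crosses c (f xor s) ≡ f xor crosses c s
crosses-xor blue f s = refl
crosses-xor red false s = refl
crosses-xor red true  s = refl

-- Labelled components and the invariant of a position.

Edge : Set
Edge = Colour × ℕ × ℕ

record Labelling : Set where
  field
    component : ℕ → ℕ
    side      : ℕ → Bool
    members   : ℕ → Bool → List ℕ

open Labelling

-- An edge is assigned to the component of its first endpoint; `consistent` puts the second endpoint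
-- into the same one and fixes its side by the colour.
outside : Labelling → ℕ → Bool → Edge → ℕ
outside ℓ c s (col , i , j) with component ℓ i ≟ c
... | yes _ = escapes col (side ℓ i) s
... | no  _ = 0

outside-own : ∀ ℓ {c} s col {i} j → component ℓ i ≡ c → outside ℓ c s (col , i , j) ≡ escapes col (side ℓ i) s
outside-own ℓ {c} s col {i} j eq with component ℓ i ≟ c
... | yes _ = refl
... | no ≢  = contradiction eq ≢

outside-other : ∀ ℓ {c} s col {i} j → component ℓ i ≢ c → outside ℓ c s (col , i , j) ≡ 0
outside-other ℓ {c} s col {i} j ≢ with component ℓ i ≟ c
... | yes eq = contradiction eq ≢
... | no _   = refl

outside≤1 : ∀ ℓ c s e → outside ℓ c s e ≤ 1
outside≤1 ℓ c s (col , i , j) with component ℓ i ≟ c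
... | yes _ = escapes≤1 col (side ℓ i) s
... | no  _ = z≤n

-- S or T of component c, according to the side s.
slack : Labelling → History → ℕ → Bool → ℤ[φ]
slack ℓ h c s = potential (total (outside ℓ c s) h) (length (members ℓ c s))

slack-∷ : ∀ ℓ e h c s → slack ℓ (e ∷ h) c s ≡ slack ℓ h c s ⊕ ι (outside ℓ c s e)
slack-∷ ℓ e h c s = potential-ι (outside ℓ c s e) (total (outside ℓ c s) h) (length (members ℓ c s))

-- `single` fixes only the sizes of the sides: edges enter the slacks nonnegatively, which is all
-- that `Viable` asks for.
data ViableComponent (ℓ : Labelling) (h : History) (c : ℕ) : Set where
  good   : Good (slack ℓ h c false) (slack ℓ h c true) → ViableComponent ℓ h c
  single : length (members ℓ c false) ≡ 1 → length (members ℓ c true) ≡ 0 → ViableComponent ℓ h c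

good-at : ∀ {P : Bool → ℤ[φ]} → Good (P false) (P true) → ∀ s → Good (P s) (P (not s))
good-at g false = g
good-at g true  = good-swap g

good-from : ∀ {P : Bool → ℤ[φ]} s → Good (P s) (P (not s)) → Good (P false) (P true)
good-from false g = g
good-from true  g = good-swap g

-- `covered` makes the length of a member list an upper bound for the size of the side, the
-- direction that `golden-bound` uses.
record Invariant (h : History) : Set where
  field
    ℓ          : Labelling
    covered    : ∀ v → v ∈ members ℓ (component ℓ v) (side ℓ v)
    consistent : ∀ {col i j} → (col , i , j) ∈ h →
                 component ℓ j ≡ component ℓ i × side ℓ j ≡ crosses col (side ℓ i)
    viable     : ∀ v → ViableComponent ℓ h (component ℓ v)

open Invariant

invariant-[] : Invariant []
invariant-[] = record
  { ℓ = record { component = λ v → v ; side = λ _ → false ; members = λ { c false → c ∷ [] ; c true → [] } }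
  ; covered = λ v → here refl
  ; consistent = λ ()
  ; viable = λ v → single refl refl
  }

-- Renames the two sides relative to v, as the merge lemmas expect for an endpoint of the new edge.
viable-at : ∀ {h} (I : Invariant h) v →
  let c = component (ℓ I) v; s = side (ℓ I) v in
  Viable (slack (ℓ I) h c s) (slack (ℓ I) h c (not s))
viable-at {h} I v with viable I v
... | good g = good (good-at {slack (ℓ I) h (component (ℓ I) v)} g (side (ℓ I) v))
... | single one none with side (ℓ I) v | covered I v
...   | false | _ rewrite one | none = single (coeffs≥0 (+≤+ z≤n) (+≤+ z≤n)) (coeffs≥0 (+≤+ z≤n) (+≤+ z≤n))
-- The `true` side of a one-vertex component is empty, yet it would have to contain v.
...   | true  | v∈ with members (ℓ I) (component (ℓ I) v) true | v∈
viable-at {h} I v | single one () | true | v∈ | _ ∷ _ | _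

viable-∷ : ∀ ℓ e {h c} → ViableComponent ℓ h c → ViableComponent ℓ (e ∷ h) c
viable-∷ ℓ e {h} {c} (good g) = good (subst₂ Good (sym (slack-∷ ℓ e h c false)) (sym (slack-∷ ℓ e h c true))
  (good-mono (nonneg-ι (outside ℓ c false e)) (nonneg-ι (outside ℓ c true e)) g))
viable-∷ ℓ e (single one none) = single one none

extend-within : ∀ {h} (I : Invariant h) col i j → component (ℓ I) j ≡ component (ℓ I) i →
  side (ℓ I) j ≡ crosses col (side (ℓ I) i) → Invariant ((col , i , j) ∷ h)
extend-within I col i j same-component sides = record
  { ℓ = ℓ I
  ; covered = covered I
  ; consistent = λ { (here refl) → same-component , sides ; (there e∈) → consistent I e∈ }
  ; viable = λ v → viable-∷ (ℓ I) (col , i , j) (viable I v)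
  }

colour-between : ∀ s t → ∃[ col ] t ≡ crosses col s
colour-between false false = blue , refl
colour-between false true  = red  , refl
colour-between true  false = red  , refl
colour-between true  true  = blue , refl

-- Merging two components, with the sides of the second exchanged when f is true.

module Merge (ℓ : Labelling) (c₁ c₂ : ℕ) (c₁≢c₂ : c₁ ≢ c₂) (f : Bool) where

  component′ : ℕ → ℕ
  component′ v with component ℓ v ≟ c₂
  ... | yes _ = c₁
  ... | no  _ = component ℓ v

  side′ : ℕ → Bool
  side′ v with component ℓ v ≟ c₂
  ... | yes _ = f xor side ℓ v
  ... | no  _ = side ℓ v

  members′ : ℕ → Bool → List ℕ
  members′ c s with c ≟ c₁
  ... | yes _ = members ℓ c₁ s ++ members ℓ c₂ (f xor s)
  ... | no  _ = members ℓ c s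

  -- The label c₂ is no longer carried by any vertex; its members are stale.
  ℓ′ : Labelling
  ℓ′ = record { component = component′ ; side = side′ ; members = members′ }

  relabelled : ∀ {v} → component ℓ v ≡ c₂ → component′ v ≡ c₁ × side′ v ≡ f xor side ℓ v
  relabelled {v} eq with component ℓ v ≟ c₂
  ... | yes _ = refl , refl
  ... | no ≢  = contradiction eq ≢

  unchanged : ∀ {v} → component ℓ v ≢ c₂ → component′ v ≡ component ℓ v × side′ v ≡ side ℓ v
  unchanged {v} ≢ with component ℓ v ≟ c₂
  ... | yes eq = contradiction eq ≢
  ... | no _   = refl , refl

  members-merged : ∀ s → members′ c₁ s ≡ members ℓ c₁ s ++ members ℓ c₂ (f xor s)
  members-merged s with c₁ ≟ c₁
  ... | yes _ = refl
  ... | no ≢  = contradiction refl ≢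

  members-unchanged : ∀ {c} → c ≢ c₁ → ∀ s → members′ c s ≡ members ℓ c s
  members-unchanged {c} ≢ s with c ≟ c₁
  ... | yes eq = contradiction eq ≢
  ... | no _   = refl

  covered′ : (∀ v → v ∈ members ℓ (component ℓ v) (side ℓ v)) → ∀ v → v ∈ members′ (component′ v) (side′ v)
  covered′ cov v with component ℓ v ≟ c₂
  -- The new list flips the new side of v once more, which leads back to the old list of v.
  ... | yes eq rewrite members-merged (f xor side ℓ v) | xor-involutive f (side ℓ v) =
    ∈-++⁺ʳ _ (subst (λ c → v ∈ members ℓ c (side ℓ v)) eq (cov v))
  ... | no _ with component ℓ v ≟ c₁
  ...   | yes eq = ∈-++⁺ˡ (subst (λ c → v ∈ members ℓ c (side ℓ v)) eq (cov v))
  ...   | no _  = cov v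

  consistent′ : ∀ {col i j} → component ℓ j ≡ component ℓ i × side ℓ j ≡ crosses col (side ℓ i) →
    component′ j ≡ component′ i × side′ j ≡ crosses col (side′ i)
  consistent′ {col} {i} {j} (same , sides) with component ℓ i ≟ c₂
  ... | yes eq = let (a , b) = relabelled (trans same eq) in
    a , trans b (trans (cong (f xor_) sides) (sym (crosses-xor col f (side ℓ i))))
  ... | no ≢ = let (a , b) = unchanged (λ eq → ≢ (trans (sym same) eq)) in
    trans a same , trans b sides

  -- The old components are disjoint, so at most one summand is nonzero. For an edge from c₂ the
  -- flip of its starting side is moved to s by `escapes-xor`.
  outside-merged : ∀ s e → outside ℓ′ c₁ s e ≡ outside ℓ c₁ s e + outside ℓ c₂ (f xor s) e
  outside-merged s (col , i , j) = by-cases (component ℓ i ≟ c₁) (component ℓ i ≟ c₂)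
    where
    e : Edge
    e = col , i , j
    by-cases : Dec (component ℓ i ≡ c₁) → Dec (component ℓ i ≡ c₂) →
      outside ℓ′ c₁ s e ≡ outside ℓ c₁ s e + outside ℓ c₂ (f xor s) e
    by-cases _ (yes eq₂) = let (a , b) = relabelled eq₂ in
      trans (trans (outside-own ℓ′ s col j a)
              (trans (cong (λ t → escapes col t s) b) (escapes-xor col f (side ℓ i) s)))
        (sym (cong₂ _+_ (outside-other ℓ s col j (λ eq₁ → c₁≢c₂ (trans (sym eq₁) eq₂)))
                        (outside-own ℓ (f xor s) col j eq₂)))
    by-cases (yes eq₁) (no ≢₂) = let (a , b) = unchanged ≢₂ in
      trans (trans (outside-own ℓ′ s col j (trans a eq₁)) (cong (λ t → escapes col t s) b))
        (sym (trans (cong₂ _+_ (outside-own ℓ s col j eq₁) (outside-other ℓ (f xor s) col j ≢₂))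
                    (ℕ.+-identityʳ _)))
    by-cases (no ≢₁) (no ≢₂) = let (a , b) = unchanged ≢₂ in
      trans (outside-other ℓ′ s col j (λ eq → ≢₁ (trans (sym a) eq)))
        (sym (cong₂ _+_ (outside-other ℓ s col j ≢₁) (outside-other ℓ (f xor s) col j ≢₂)))

  outside-unchanged : ∀ {c} → c ≢ c₁ → c ≢ c₂ → ∀ s e → outside ℓ′ c s e ≡ outside ℓ c s e
  outside-unchanged {c} c≢c₁ c≢c₂ s (col , i , j) = by-cases (component ℓ i ≟ c) (component ℓ i ≟ c₂)
    where
    by-cases : Dec (component ℓ i ≡ c) → Dec (component ℓ i ≡ c₂) →
      outside ℓ′ c s (col , i , j) ≡ outside ℓ c s (col , i , j)
    by-cases _ (yes eq₂) =
      trans (outside-other ℓ′ s col j (λ eq → c≢c₁ (trans (sym eq) (proj₁ (relabelled eq₂)))))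
        (sym (outside-other ℓ s col j (λ eq → c≢c₂ (trans (sym eq) eq₂))))
    by-cases (yes eq) (no ≢₂) = let (a , b) = unchanged ≢₂ in
      trans (trans (outside-own ℓ′ s col j (trans a eq)) (cong (λ t → escapes col t s) b))
        (sym (outside-own ℓ s col j eq))
    by-cases (no ≢) (no ≢₂) =
      trans (outside-other ℓ′ s col j (λ eq → ≢ (trans (sym (proj₁ (unchanged ≢₂))) eq)))
        (sym (outside-other ℓ s col j ≢))

  slack-merged : ∀ h s → slack ℓ′ h c₁ s ≡ slack ℓ h c₁ s ⊕ slack ℓ h c₂ (f xor s)
  slack-merged h s = trans
    (cong₂ potential (total-+ (outside-merged s) h)
      (trans (cong length (members-merged s)) (length-++ (members ℓ c₁ s))))
    (potential-+ (total (outside ℓ c₁ s) h) (length (members ℓ c₁ s)) _ _)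

  slack-unchanged : ∀ {c} → c ≢ c₁ → c ≢ c₂ → ∀ h s → slack ℓ′ h c s ≡ slack ℓ h c s
  slack-unchanged c≢c₁ c≢c₂ h s =
    cong₂ potential (total-cong (outside-unchanged c≢c₁ c≢c₂ s) h)
      (cong length (members-unchanged c≢c₁ s))

  viable-unchanged : ∀ {c} → c ≢ c₁ → c ≢ c₂ → ∀ {h} → ViableComponent ℓ h c → ViableComponent ℓ′ h c
  viable-unchanged c≢c₁ c≢c₂ {h} (good g) =
    good (subst₂ Good (sym (slack-unchanged c≢c₁ c≢c₂ h false)) (sym (slack-unchanged c≢c₁ c≢c₂ h true)) g)
  viable-unchanged c≢c₁ c≢c₂ (single one none) =
    single (trans (cong length (members-unchanged c≢c₁ false)) one)
           (trans (cong length (members-unchanged c≢c₁ true)) none)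

-- Painter's reply.

-- The flip of the second component that makes an edge of the given colour between sides s and t consistent.
flip : Colour → Bool → Bool → Bool
flip col s t = crosses col (s xor t)

flip-consistent : ∀ col s t → flip col s t xor t ≡ crosses col s
flip-consistent red  false false = refl
flip-consistent red  false true  = refl
flip-consistent red  true  false = refl
flip-consistent red  true  true  = refl
flip-consistent blue false false = refl
flip-consistent blue false true  = refl
flip-consistent blue true  false = refl
flip-consistent blue true  true  = refl

-- Sides are named as in the first component; the last summand is the contribution of the new edge.
mergedSlack : (P₁ P₂ : Bool → ℤ[φ]) (s₁ s₂ : Bool) → Colour → Bool → ℤ[φ]
mergedSlack P₁ P₂ s₁ s₂ col s = P₁ s ⊕ P₂ (flip col s₁ s₂ xor s) ⊕ ι (escapes col s₁ s)

extend-merge : ∀ {h} (I : Invariant h) col i j → component (ℓ I) i ≢ component (ℓ I) j →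
  let P = mergedSlack (slack (ℓ I) h (component (ℓ I) i)) (slack (ℓ I) h (component (ℓ I) j))
            (side (ℓ I) i) (side (ℓ I) j) col in
  Good (P false) (P true) → Invariant ((col , i , j) ∷ h)
extend-merge {h} I col i j c₁≢c₂ g = record
  { ℓ = ℓ′
  ; covered = covered′ (covered I)
  ; consistent = λ { (here refl) → trans (proj₁ j-new) (sym (proj₁ i-new)) ,
                                    trans (proj₂ j-new) (trans (flip-consistent col s₁ s₂)
                                      (cong (crosses col) (sym (proj₂ i-new))))
                   ; {col′} (there e∈) → consistent′ {col′} (consistent I e∈) }
  ; viable = viable′
  }
  where
  c₁ = component (ℓ I) i
  c₂ = component (ℓ I) j
  s₁ = side (ℓ I) i
  s₂ = side (ℓ I) j
  open Merge (ℓ I) c₁ c₂ c₁≢c₂ (flip col s₁ s₂)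
  i-new : component′ i ≡ c₁ × side′ i ≡ s₁
  i-new = unchanged c₁≢c₂
  j-new : component′ j ≡ c₁ × side′ j ≡ flip col s₁ s₂ xor s₂
  j-new = relabelled refl
  P : Bool → ℤ[φ]
  P = mergedSlack (slack (ℓ I) h c₁) (slack (ℓ I) h c₂) s₁ s₂ col
  slack-new : ∀ s → P s ≡ slack ℓ′ ((col , i , j) ∷ h) c₁ s
  slack-new s = sym (trans (slack-∷ ℓ′ (col , i , j) h c₁ s)
    (cong₂ _⊕_ (slack-merged h s)
      (cong ι (trans (outside-own ℓ′ s col j (proj₁ i-new)) (cong (λ t → escapes col t s) (proj₂ i-new))))))
  viable-c₁ : ViableComponent ℓ′ ((col , i , j) ∷ h) c₁
  viable-c₁ = good (subst₂ Good (slack-new false) (slack-new true) g)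
  viable′ : ∀ v → ViableComponent ℓ′ ((col , i , j) ∷ h) (component′ v)
  viable′ v with component (ℓ I) v ≟ c₂
  ... | yes _ = viable-c₁
  ... | no ≢₂ with component (ℓ I) v ≟ c₁
  ...   | yes eq = subst (ViableComponent ℓ′ _) (sym eq) viable-c₁
  ...   | no ≢₁  = viable-∷ ℓ′ (col , i , j) (viable-unchanged ≢₁ ≢₂ (viable I v))

-- Passes from sides relative to the endpoints to the absolute sides `false` and `true`; for
-- concrete s₁ and s₂ both forms agree by computation. The summand 𝟘 is what a blue edge adds on its
-- own side.
blueMerge⇒good : ∀ (P₁ P₂ : Bool → ℤ[φ]) s₁ s₂ → BlueMerge (P₁ s₁) (P₁ (not s₁)) (P₂ s₂) (P₂ (not s₂)) →
  let P = mergedSlack P₁ P₂ s₁ s₂ blue in Good (P false) (P true)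
blueMerge⇒good P₁ P₂ s₁ s₂ (blueMerge g) =
  good-from {mergedSlack P₁ P₂ s₁ s₂ blue} s₁ (oriented s₁ s₂ (subst (λ S → Good S (P₁ (not s₁) ⊕ P₂ (not s₂) ⊕ 𝟙)) (sym (⊕-identityʳ (P₁ s₁ ⊕ P₂ s₂))) g))
  where
  oriented : ∀ s₁ s₂ → Good (P₁ s₁ ⊕ P₂ s₂ ⊕ 𝟘) (P₁ (not s₁) ⊕ P₂ (not s₂) ⊕ 𝟙) →
    Good (mergedSlack P₁ P₂ s₁ s₂ blue s₁) (mergedSlack P₁ P₂ s₁ s₂ blue (not s₁))
  oriented false false g = g
  oriented false true  g = g
  oriented true  false g = g
  oriented true  true  g = g

redMerge⇒good : ∀ (P₁ P₂ : Bool → ℤ[φ]) s₁ s₂ → RedMerge (P₁ s₁) (P₁ (not s₁)) (P₂ s₂) (P₂ (not s₂)) →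
  let P = mergedSlack P₁ P₂ s₁ s₂ red in Good (P false) (P true)
redMerge⇒good P₁ P₂ s₁ s₂ (redMerge g) =
  good-from {mergedSlack P₁ P₂ s₁ s₂ red} s₁ (oriented s₁ s₂ g)
  where
  oriented : ∀ s₁ s₂ → Good (P₁ s₁ ⊕ P₂ (not s₂) ⊕ 𝟙) (P₁ (not s₁) ⊕ P₂ s₂ ⊕ 𝟙) →
    Good (mergedSlack P₁ P₂ s₁ s₂ red s₁) (mergedSlack P₁ P₂ s₁ s₂ red (not s₁))
  oriented false false g = g
  oriented false true  g = g
  oriented true  false g = g
  oriented true  true  g = g

painter-reply : ∀ {h} → Invariant h → ∀ i j → ∃[ col ] Invariant ((col , i , j) ∷ h)
painter-reply {h} I i j with component (ℓ I) j ≟ component (ℓ I) i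
... | yes same = let (col , sides) = colour-between (side (ℓ I) i) (side (ℓ I) j) in
  col , extend-within I col i j same sides
... | no different with merge-viable (viable-at I i) (viable-at I j)
...   | inj₁ b = blue , extend-merge I blue i j (different ∘ sym)
          (blueMerge⇒good (slack (ℓ I) h _) (slack (ℓ I) h _) (side (ℓ I) i) (side (ℓ I) j) b)
...   | inj₂ r = red , extend-merge I red i j (different ∘ sym)
          (redMerge⇒good (slack (ℓ I) h _) (slack (ℓ I) h _) (side (ℓ I) i) (side (ℓ I) j) r)

-- The end of the game.

adj-consistent : ∀ {h} (I : Invariant h) {col u v} → Adj col h u v →
  component (ℓ I) v ≡ component (ℓ I) u × side (ℓ I) v ≡ crosses col (side (ℓ I) u)
adj-consistent I (inj₁ e∈) = consistent I e∈
adj-consistent I {red} (inj₂ e∈) = let (a , b) = consistent I e∈ in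
  -- Negation is an involution, so a red edge read backwards changes side as well.
  sym a , trans (sym (xor-involutive true _)) (cong not (sym b))
adj-consistent I {blue} (inj₂ e∈) = let (a , b) = consistent I e∈ in sym a , sym b

odd : ℕ → Bool
odd zero    = false
odd (suc i) = not (odd i)

odd-2* : ∀ k → odd (2 * k) ≡ false
odd-2* zero    = refl
odd-2* (suc k) = trans (cong odd (ℕ.*-suc 2 k)) (trans (not-involutive _) (odd-2* k))

-- Sides alternate along the path. Its last index 2 + 2k is even, so the closing red edge would join
-- two vertices of the same side.
no-red-odd-cycle : ∀ {h} → Invariant h → ¬ RedOddCycle h
no-red-odd-cycle I (k , v , _ , path , closing) =
  not-¬ refl (trans (proj₂ (adj-consistent I closing)) (cong not last-side))
  where
  alternating : ∀ i → i < 3 + 2 * k → side (ℓ I) (v i) ≡ odd i xor side (ℓ I) (v 0)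
  alternating zero    _   = refl
  alternating (suc i) i<L = trans (proj₂ (adj-consistent I (path i i<L)))
    (trans (cong not (alternating i (ℕ.<-trans (ℕ.n<1+n i) i<L))) (not-distribˡ-xor (odd i) _))
  last-side : side (ℓ I) (v (2 + 2 * k)) ≡ side (ℓ I) (v 0)
  last-side = trans (alternating (2 + 2 * k) (ℕ.n<1+n _))
    (cong (_xor side (ℓ I) (v 0)) (trans (not-involutive _) (odd-2* k)))

edgeOf : ∀ {h u v} → Adj blue h u v → Edge
edgeOf {u = u} {v} (inj₁ _) = blue , u , v
edgeOf {u = u} {v} (inj₂ _) = blue , v , u

edgeOf-∈ : ∀ {h u v} (a : Adj blue h u v) → edgeOf a ∈ h
edgeOf-∈ (inj₁ e∈) = e∈
edgeOf-∈ (inj₂ e∈) = e∈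

edgeOf-injective : ∀ {h u v u′ v′} (a : Adj blue h u v) (a′ : Adj blue h u′ v′) →
  edgeOf a ≡ edgeOf a′ → (u ≡ u′ × v ≡ v′) ⊎ (u ≡ v′ × v ≡ u′)
edgeOf-injective (inj₁ _) (inj₁ _) refl = inj₁ (refl , refl)
edgeOf-injective (inj₁ _) (inj₂ _) refl = inj₂ (refl , refl)
edgeOf-injective (inj₂ _) (inj₁ _) refl = inj₂ (refl , refl)
edgeOf-injective (inj₂ _) (inj₂ _) refl = inj₁ (refl , refl)

module BlueCopy {n m h} (I : Invariant h) (G : ConGraph n m) (f : Fin n → ℕ)
  (f-inj : Injective _≡_ _≡_ f) (copy : ∀ a b → GAdj G a b → Adj blue h (f a) (f b)) (r : Fin n) where

  c : ℕ
  c = component (ℓ I) (f r)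

  s : Bool
  s = side (ℓ I) (f r)

  -- Blue edges preserve component and side, so connectedness puts the whole copy into one side.
  one-side : ∀ {a b} → Star (GAdj G) a b →
    component (ℓ I) (f b) ≡ component (ℓ I) (f a) × side (ℓ I) (f b) ≡ side (ℓ I) (f a)
  one-side ε = refl , refl
  one-side (e ◅ es) = let (p , q) = one-side es; (p′ , q′) = adj-consistent I (copy _ _ e) in
    trans p p′ , trans q q′

  in-class : ∀ a → component (ℓ I) (f a) ≡ c × side (ℓ I) (f a) ≡ s
  in-class a = one-side (connected G r a)

  n≤members : n ≤ length (members (ℓ I) c s)
  n≤members = injective-∈⇒≤ f-inj λ a → let (p , q) = in-class a in
    subst₂ (λ c s → f a ∈ members (ℓ I) c s) p q (covered I (f a))

  inside : List Edge
  inside = filter (λ e → outside (ℓ I) c s e ≟ 0) h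

  starts-inside : ∀ a v → outside (ℓ I) c s (blue , f a , v) ≡ 0
  starts-inside a v = let (p , q) = in-class a in
    trans (outside-own (ℓ I) s blue v p) (trans (cong (λ t → escapes blue t s) q) (escapes-inside s))

  edgeOf-inside : ∀ {a b} (e : Adj blue h (f a) (f b)) → outside (ℓ I) c s (edgeOf e) ≡ 0
  edgeOf-inside {a} {b} (inj₁ _) = starts-inside a (f b)
  edgeOf-inside {a} {b} (inj₂ _) = starts-inside b (f a)

  adj : ∀ p → let (a , b) = lookup (edges G) p in Adj blue h (f a) (f b)
  adj p = copy _ _ (inj₁ (∈-lookup p))

  edgeOf-adj-injective : Injective _≡_ _≡_ (λ p → edgeOf (adj p))
  edgeOf-adj-injective {p} {q} eq with edgeOf-injective (adj p) (adj q) eq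
  ... | inj₁ (eq₁ , eq₂) = unique⇒lookup-injective (distinct G) (cong₂ _,_ (f-inj eq₁) (f-inj eq₂))
  -- The same edge with its ends exchanged would be increasing in both directions.
  ... | inj₂ (eq₁ , eq₂) = contradiction
    (subst₂ Fin._<_ (f-inj eq₁) (f-inj eq₂) (All.lookup (ordered G) (∈-lookup p)))
    (Fin.<-asym (All.lookup (ordered G) (∈-lookup q)))

  m≤inside : m ≤ length inside
  m≤inside = ℕ.≤-trans (manyEdges G) (injective-∈⇒≤ edgeOf-adj-injective
    λ p → ∈-filter⁺ (λ e → outside (ℓ I) c s e ≟ 0) (edgeOf-∈ (adj p)) (edgeOf-inside (adj p)))

  m+outside≤length : m + total (outside (ℓ I) c s) h ≤ length h
  m+outside≤length = ℕ.≤-trans (ℕ.+-monoˡ-≤ _ m≤inside)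
    (length-zeros+total≤length (outside≤1 (ℓ I) c s) h)

  bound : ∀ {t} → 2 ≤ n → length h ≤ t → GoldenBoundLe n m t
  bound 2≤n h≤t with viable I (f r)
  ... | good g = golden-bound {m = m} {x = total (outside (ℓ I) c s) h} 2≤n n≤members (ℕ.≤-trans m+outside≤length h≤t)
                   (S≥-√5 (good-at {slack (ℓ I) h c} g s))
  -- At least two vertices of the copy would have to lie in a list of length at most one.
  ... | single one none = contradiction (ℕ.≤-trans 2≤n (ℕ.≤-trans n≤members (at-most-one s))) λ { (s≤s ()) }
    where
    at-most-one : ∀ s → length (members (ℓ I) c s) ≤ 1
    at-most-one false = ℕ.≤-reflexive one
    at-most-one true  = ℕ.≤-trans (ℕ.≤-reflexive none) z≤n

gameOver-bound : ∀ {n m h t} → 2 ≤ n → Invariant h → GameOver n m h → length h ≤ t → GoldenBoundLe n m t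
gameOver-bound 2≤n I (inj₁ cycle) _ = contradiction cycle (no-red-odd-cycle I)
gameOver-bound 2≤n I (inj₂ (G , f , f-inj , copy)) h≤t =
  -- As n ≥ 2, vertex 0 exists and serves as the root.
  BlueCopy.bound I G f f-inj copy (Fin.fromℕ< (ℕ.<-trans (s≤s z≤n) 2≤n)) 2≤n h≤t

-- Induction along the branch of Builder's strategy selected by Painter's replies; rounds played
-- plus rounds left never exceed T.
builderWins-bound : ∀ {n m h t T} → 2 ≤ n → Invariant h → BuilderWins (GameOver n m) t h →
  length h + t ≤ T → GoldenBoundLe n m T
builderWins-bound {h = h} {suc t} 2≤n I (move i j _ _ reply) h+t≤T with painter-reply I i j
... | col , I′ with reply col
...   | inj₁ over = gameOver-bound 2≤n I′ over
          (ℕ.≤-trans (s≤s (ℕ.m≤m+n (length h) t)) (ℕ.≤-trans (ℕ.≤-reflexive (sym (ℕ.+-suc (length h) t))) h+t≤T))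
...   | inj₂ wins = builderWins-bound 2≤n I′ wins
          (ℕ.≤-trans (ℕ.≤-reflexive (sym (ℕ.+-suc (length h) t))) h+t≤T)

theorem1 : ∀ (n m : ℕ) → 1 ≤ n → 1 ≤ m → n ∸ 1 ≤ m → m ≤ n C 2 →
    OnlineRamseyAtLeast n m (GoldenBoundLe n m)
-- `1 C 2` evaluates to 0, against 1 ≤ m.
theorem1 (suc zero) m _ 1≤m _ m≤0 t _ = contradiction (ℕ.≤-trans 1≤m m≤0) λ ()
theorem1 (suc (suc n)) m _ _ _ _ t wins = builderWins-bound (s≤s (s≤s z≤n)) invariant-[] wins ℕ.≤-refl
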